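{- For a finite list $L=[l_1,l_2,\dots,l_n]$ of nonnegative integers, let $A(L)$ denote the number of words that contain exactly $l_j$ copies of the letter $j$ for each $1\le j\le n$ (and no other letters) and avoid the pattern $123$; the empty word is counted, so $A(L)=1$ if all $l_j=0$. If $l_1+\dots+l_n\ge 1$, then $$A(L)=\sum_{\substack{1\le i\le n\\ l_i\ge 1}} A\big([\,l_1,l_2,\dots,l_{i-1},\ l_i-1,\ l_{i+1}+l_{i+2}+\dots+l_n\,]\big),$$ where for $i=n$ the last entry $l_{i+1}+\dots+l_n$ is the empty sum $0$.
   Context: A word $w_1\cdots w_m$ over the positive integers contains a pattern $p_1\cdots p_k$ if there are indices $i_1<\dots<i_k$ such that for all $r,s$: $w_{i_r}<w_{i_s}\iff p_r<p_s$ and $w_{i_r}>w_{i_s}\iff p_r>p_s$; otherwise it avoids it. In particular, containing $123$ means having three positions $i_1<i_2<i_3$ with $w_{i_1}<w_{i_2}<w_{i_3}$. -}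

module Defs where

open import Data.Fin.Base as Fin using (Fin; zero; suc; toℕ)
import Data.Fin.Properties as Fin
open import Data.List.Base
  using (List; []; _∷_; _++_; length; lookup; map; filter; tabulate;
         take; drop; allFin; upTo; cartesianProductWith)
open import Data.List.Membership.Propositional using (_∈_)
open import Data.List.Membership.Propositional.Properties
  using (∈-map⁺; ∈-upTo⁺; ∈-cartesianProductWith⁺; ∈-filter⁺; ∈-filter⁻)
open import Data.List.Properties
  using (tabulate-cong; tabulate-lookup; ∷-injective; filter-accept; filter-reject)
open import Data.List.Relation.Unary.All as All using (All; []; _∷_)
open import Data.List.Relation.Unary.Any using (here)
open import Data.List.Relation.Unary.Unique.Propositional using (Unique; []; _∷_)
import Data.List.Relation.Unary.Unique.Propositional.Properties as Unique
open import Data.Nat.Base using (ℕ; zero; suc; _+_; _∸_; _≤_; _<_; _>_; z≤n; s≤s; s<s⁻¹)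
open import Data.Nat.ListAction using (sum)
open import Data.Nat.Properties using (_≟_; _≤?_; _<?_; suc-injective)
open import Data.Nat.Tactic.RingSolver using (solve-∀)
open import Data.Product.Base using (_×_; _,_; proj₂; ∃)
open import Data.Vec.Base as Vec using (Vec; []; _∷_)
open import Data.Vec.Relation.Unary.Linked using (Linked; linked?)
open import Function.Base using (_∘_)
open import Function.Bundles using (_⇔_; mk⇔; Equivalence)
open import Relation.Binary.PropositionalEquality
  using (_≡_; refl; sym; trans; cong; cong₂)
open import Relation.Nullary using (¬_; Dec; yes; no; contradiction)
open import Relation.Nullary.Decidable using (map′; _×-dec_; _→-dec_; ¬?)

Word : Set
Word = List ℕ

OccursAt : (p w : Word) → Vec (Fin (length w)) (length p) → Set
OccursAt p w is =
  Linked Fin._<_ is ×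
  (∀ r s →
    let wᵣ = lookup w (Vec.lookup is r)
        wₛ = lookup w (Vec.lookup is s)
        pᵣ = lookup p r
        pₛ = lookup p s
    in (wᵣ < wₛ ⇔ pᵣ < pₛ) × (wᵣ > wₛ ⇔ pᵣ > pₛ))

_Contains_ : (w p : Word) → Set
w Contains p = ∃ (OccursAt p w)

_Avoids_ : (w p : Word) → Set
w Avoids p = ¬ (w Contains p)

123-pattern : Word
123-pattern = 1 ∷ 2 ∷ 3 ∷ []

occurrences : ℕ → Word → ℕ
occurrences a w = length (filter (a ≟_) w)

-- The list index j is 0-based, so it stands for the letter suc (toℕ j).
HasContent : List ℕ → Word → Set
HasContent L w =
  All (λ a → 1 ≤ a × a ≤ length L) w ×
  (∀ (j : Fin (length L)) → occurrences (suc (toℕ j)) w ≡ lookup L j)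

private
  _⇔-dec_ : {P Q : Set} → Dec P → Dec Q → Dec (P ⇔ Q)
  p? ⇔-dec q? =
    map′ (λ (f , g) → mk⇔ f g)
         (λ e → Equivalence.to e , Equivalence.from e)
         ((p? →-dec q?) ×-dec (q? →-dec p?))

  anyVec? : ∀ {m} k {P : Vec (Fin m) k → Set} → (∀ v → Dec (P v)) → Dec (∃ P)
  anyVec? zero P? = map′ ([] ,_) (λ { ([] , p) → p }) (P? [])
  anyVec? (suc k) P? =
    map′ (λ { (x , v , p) → x ∷ v , p }) (λ { (x ∷ v , p) → x , v , p })
         (Fin.any? λ x → anyVec? k λ v → P? (x ∷ v))

occursAt? : ∀ p w is → Dec (OccursAt p w is)
occursAt? p w is =
  linked? Fin._<?_ is ×-dec
  Fin.all? λ r → Fin.all? λ s →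
    ((_ <? _) ⇔-dec (_ <? _)) ×-dec ((_ <? _) ⇔-dec (_ <? _))

_contains?_ : ∀ w p → Dec (w Contains p)
w contains? p = anyVec? (length p) (occursAt? p w)

_avoids?_ : ∀ w p → Dec (w Avoids p)
w avoids? p = ¬? (w contains? p)

hasContent? : ∀ L w → Dec (HasContent L w)
hasContent? L w =
  All.all? (λ a → (1 ≤? a) ×-dec (a ≤? length L)) w ×-dec
  Fin.all? λ j → occurrences (suc (toℕ j)) w ≟ lookup L j

wordsOver : (n m : ℕ) → List Word
wordsOver n zero    = [] ∷ []
wordsOver n (suc m) = cartesianProductWith _∷_ (map suc (upTo n)) (wordsOver n m)

avoiders : List ℕ → List Word
avoiders L =
  filter (λ w → hasContent? L w ×-dec (w avoids? 123-pattern))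
         (wordsOver (length L) (sum L))

A : List ℕ → ℕ
A L = length (avoiders L)

reduceAt : (L : List ℕ) → Fin (length L) → List ℕ
reduceAt L i =
  take (toℕ i) L ++ (lookup L i ∸ 1) ∷ sum (drop (suc (toℕ i)) L) ∷ []

support : (L : List ℕ) → List (Fin (length L))
support L = filter (λ i → 1 ≤? lookup L i) (allFin (length L))

-- The rest shows that restricting to words of length sum L loses nothing:
-- avoiders L lists each word with content L avoiding 123 exactly once.

private
  wordsOver-unique : ∀ n m → Unique (wordsOver n m)
  wordsOver-unique n zero    = [] ∷ []
  wordsOver-unique n (suc m) =
    Unique.cartesianProductWith⁺ _∷_ ∷-injective
      (Unique.map⁺ suc-injective (Unique.upTo⁺ n)) (wordsOver-unique n m)

  wordsOver-complete : ∀ {n} w → All (λ a → 1 ≤ a × a ≤ n) w →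
                       w ∈ wordsOver n (length w)
  wordsOver-complete []          []                   = here refl
  wordsOver-complete (suc a ∷ w) ((_ , a<n) ∷ bounds) =
    ∈-cartesianProductWith⁺ _∷_ (∈-map⁺ suc (∈-upTo⁺ a<n)) (wordsOver-complete w bounds)

  δ : ℕ → ℕ → ℕ
  δ zero    zero    = 1
  δ zero    (suc _) = 0
  δ (suc _) zero    = 0
  δ (suc a) (suc b) = δ a b

  δ-refl : ∀ a → δ a a ≡ 1
  δ-refl zero    = refl
  δ-refl (suc a) = δ-refl a

  δ-≢ : ∀ a b → ¬ a ≡ b → δ a b ≡ 0
  δ-≢ zero    zero    a≢b = contradiction refl a≢b
  δ-≢ zero    (suc b) a≢b = refl
  δ-≢ (suc a) zero    a≢b = refl
  δ-≢ (suc a) (suc b) a≢b = δ-≢ a b (a≢b ∘ cong suc)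

  occurrences-∷ : ∀ a x w → occurrences a (x ∷ w) ≡ δ a x + occurrences a w
  occurrences-∷ a x w with a ≟ x
  ... | yes refl = trans (cong length (filter-accept (a ≟_) refl))
                         (cong (_+ occurrences a w) (sym (δ-refl a)))
  ... | no a≢x   = trans (cong length (filter-reject (a ≟_) a≢x))
                         (cong (_+ occurrences a w) (sym (δ-≢ a x a≢x)))

  sum-zero : ∀ n → sum (tabulate {n = n} (λ _ → 0)) ≡ 0
  sum-zero zero    = refl
  sum-zero (suc n) = sum-zero n

  sum-δ : ∀ n x → x < n → sum (tabulate {n = n} (λ j → δ (toℕ j) x)) ≡ 1
  sum-δ (suc n) zero    _   = cong suc (sum-zero n)
  sum-δ (suc n) (suc x) x<n = sum-δ n x (s<s⁻¹ x<n)

  interchange : ∀ a b c d → (a + b) + (c + d) ≡ (a + c) + (b + d)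
  interchange = solve-∀

  sum-+ : ∀ n (f g : Fin n → ℕ) →
          sum (tabulate (λ j → f j + g j)) ≡ sum (tabulate f) + sum (tabulate g)
  sum-+ zero    f g = refl
  sum-+ (suc n) f g =
    trans (cong (f zero + g zero +_) (sum-+ n (f ∘ suc) (g ∘ suc)))
          (interchange (f zero) (g zero) _ _)

  sum-occurrences : ∀ {n} w → All (λ a → 1 ≤ a × a ≤ n) w →
    sum (tabulate {n = n} (λ j → occurrences (suc (toℕ j)) w)) ≡ length w
  sum-occurrences {n} [] [] = sum-zero n
  sum-occurrences {n} (suc x ∷ w) ((_ , x<n) ∷ bounds) =
    trans (cong sum (tabulate-cong {n = n} λ j → occurrences-∷ (suc (toℕ j)) (suc x) w))
   (trans (sum-+ n (λ j → δ (toℕ j) x) _)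
          (cong₂ _+_ (sum-δ n x x<n) (sum-occurrences w bounds)))

content-length : ∀ L w → HasContent L w → length w ≡ sum L
content-length L w (bounds , counts) =
  trans (sym (sum-occurrences w bounds))
        (cong sum (trans (tabulate-cong counts) (tabulate-lookup L)))

avoiders-unique : ∀ L → Unique (avoiders L)
avoiders-unique L = Unique.filter⁺ _ (wordsOver-unique (length L) (sum L))

∈-avoiders : ∀ L w → w ∈ avoiders L ⇔ (HasContent L w × w Avoids 123-pattern)
∈-avoiders L w = mk⇔ (proj₂ ∘ ∈-filter⁻ good? {xs = wordsOver (length L) (sum L)}) from
  where
  good? : ∀ v → Dec (HasContent L v × v Avoids 123-pattern)
  good? v = hasContent? L v ×-dec (v avoids? 123-pattern)

  from : HasContent L w × w Avoids 123-pattern → w ∈ avoiders L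
  from (content@(bounds , _) , avoids)
    rewrite sym (content-length L w content)
    = ∈-filter⁺ good? (wordsOver-complete w bounds) (content , avoids)

{-# OPTIONS --safe #-}

-- Write a word avoiding 123 as p ∷ v.  Then the letters of v above p weakly
-- decrease, so they are determined by their multiplicities together with the
-- positions they occupy, and merging them all into the letter p + 1 loses
-- nothing.  Merging neither creates nor destroys a 123: the middle letter of
-- a 123 in v is at most p, since the letters above p decrease.  Hence v ranges
-- over a set in bijection with the 123-avoiders of the p-th reduced content.

module Submission where

open import Defs
open import Data.Nat.Base
  using (ℕ; zero; suc; _+_; _∸_; _⊓_; _≤_; _<_; _≥_; _>_; z≤n; s≤s; s≤s⁻¹; z<s; s<s)
open import Data.Nat.ListAction using (sum)
open import Data.Nat.Properties
open import Data.Fin.Base as Fin using (Fin; zero; suc; toℕ; fromℕ<)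
open import Data.Fin.Properties using (toℕ-fromℕ<; toℕ-injective)
open import Data.List.Base
  using (List; []; _∷_; _++_; length; lookup; map; filter; replicate; drop;
         tabulate; concatMap; allFin)
open import Data.List.Membership.Propositional using (_∈_; find; lose)
open import Data.List.Membership.Propositional.Properties
  using (∈-lookup; ∈-map⁺; ∈-map⁻; ∈-filter⁺; ∈-filter⁻; ∈-concatMap⁺; ∈-concatMap⁻; ∈-allFin)
open import Data.List.Membership.Propositional.Properties.WithK using (unique∧set⇒bag)
open import Data.List.Properties
open import Data.List.Relation.Binary.BagAndSetEquality using (∼bag⇒↭)
open import Data.List.Relation.Binary.Disjoint.Propositional using (Disjoint)
open import Data.List.Relation.Binary.Permutation.Propositional.Properties using (↭-length)
open import Data.List.Relation.Unary.All as All using (All; []; _∷_)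
import Data.List.Relation.Unary.All.Properties as All
open import Data.List.Relation.Unary.AllPairs as AllPairs using (AllPairs; []; _∷_)
import Data.List.Relation.Unary.AllPairs.Properties as AllPairs
open import Data.List.Relation.Unary.Any using (here)
open import Data.List.Relation.Unary.Unique.Propositional using (Unique)
import Data.List.Relation.Unary.Unique.Propositional.Properties as Unique
open import Data.Product.Base using (_×_; _,_; proj₁; proj₂; ∃₂)
open import Data.Sum.Base using (inj₁; inj₂)
open import Data.Vec.Base as Vec using ([]; _∷_)
open import Data.Vec.Relation.Unary.Linked using ([-]; _∷_)
open import Function.Base using (_∘_; case_of_)
open import Function.Bundles using (_⇔_; mk⇔; Equivalence)
open import Level using (0ℓ)
open import Relation.Binary.Core using (Rel)
open import Relation.Binary.Definitions using (tri<; tri≈; tri>)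
open import Relation.Binary.PropositionalEquality
open import Relation.Nullary using (yes; no; contradiction)
open import Relation.Unary using (Pred; Decidable; _⊆_)

open Equivalence using (to; from)

-- Lists: pairs of positions, filters, uniqueness and counting

module _ {A : Set} {R : Rel A 0ℓ} where

  allPairs-lookup⁺ : ∀ {xs} → AllPairs R xs →
                     ∀ {i j} → i Fin.< j → R (lookup xs i) (lookup xs j)
  allPairs-lookup⁺ (px ∷ _)  {zero}  {suc j} _   = All.lookup px (∈-lookup j)
  allPairs-lookup⁺ (_ ∷ pxs) {suc i} {suc j} i<j = allPairs-lookup⁺ pxs (s≤s⁻¹ i<j)

  allPairs-lookup⁻ : ∀ xs → (∀ {i j} → i Fin.< j → R (lookup xs i) (lookup xs j)) →
                     AllPairs R xs
  allPairs-lookup⁻ xs r = subst (AllPairs R) (tabulate-lookup xs) (AllPairs.tabulate⁺-< r)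

length-filter-map : {A B : Set} {P : Pred B 0ℓ} (P? : Decidable P) (f : A → B) → ∀ xs →
                    length (filter P? (map f xs)) ≡ length (filter (P? ∘ f) xs)
length-filter-map P? f [] = refl
length-filter-map P? f (x ∷ xs) with P? (f x)
... | yes _ = cong suc (length-filter-map P? f xs)
... | no _  = length-filter-map P? f xs

filter-filter-⊆ : {A : Set} {P Q : Pred A 0ℓ} (P? : Decidable P) (Q? : Decidable Q) →
                  P ⊆ Q → ∀ xs → filter P? (filter Q? xs) ≡ filter P? xs
filter-filter-⊆ P? Q? P⊆Q [] = refl
filter-filter-⊆ P? Q? P⊆Q (x ∷ xs) with Q? x
... | no ¬q = trans (filter-filter-⊆ P? Q? P⊆Q xs) (sym (filter-reject P? (¬q ∘ P⊆Q)))
... | yes _ with P? x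
...   | yes _ = cong (x ∷_) (filter-filter-⊆ P? Q? P⊆Q xs)
...   | no _  = filter-filter-⊆ P? Q? P⊆Q xs

length-concatMap : {A B : Set} (f : A → List B) → ∀ xs →
                   length (concatMap f xs) ≡ sum (map (length ∘ f) xs)
length-concatMap f []       = refl
length-concatMap f (x ∷ xs) =
  trans (length-++ (f x)) (cong (length (f x) +_) (length-concatMap f xs))

-- Mapping back by `g` returns `xs`, so a repetition in the image would be one in `xs`. The inverse
-- law is asked only on `xs` because `restore` need not be injective on arbitrary words.
unique-map-leftInverse : {A B : Set} {f : A → B} (g : B → A) → ∀ {xs} →
                         All (λ x → g (f x) ≡ x) xs → Unique xs → Unique (map f xs)
unique-map-leftInverse {f = f} g {xs} gf≡id xs! =
  Unique.map⁻ {f = g} (subst Unique (trans (sym (map-id-local gf≡id)) (map-∘ xs)) xs!)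

disjoint-map : {A B : Set} {f g : A → B} → (∀ x y → f x ≢ g y) → ∀ xs ys →
               Disjoint (map f xs) (map g ys)
disjoint-map {f = f} {g} f≢g xs ys (z∈ , z∈′) =
  let x , _ , z≡fx = ∈-map⁻ f z∈
      y , _ , z≡gy = ∈-map⁻ g z∈′
  in f≢g x y (trans (sym z≡fx) z≡gy)

∈-concatMap-map⁻ : {A B C : Set} (f : A → B → C) (g : A → List B) → ∀ {z} xs →
                   z ∈ concatMap (λ x → map (f x) (g x)) xs →
                   ∃₂ λ x y → x ∈ xs × y ∈ g x × z ≡ f x y
∈-concatMap-map⁻ f g xs z∈ =
  let x , x∈ , z∈x = find (∈-concatMap⁻ (λ x → map (f x) (g x)) {xs = xs} z∈)
      y , y∈ , z≡  = ∈-map⁻ (f x) z∈x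
  in x , y , x∈ , y∈ , z≡

∈-concatMap-map⁺ : {A B C : Set} (f : A → B → C) (g : A → List B) → ∀ {xs x y} →
                   x ∈ xs → y ∈ g x → f x y ∈ concatMap (λ x → map (f x) (g x)) xs
∈-concatMap-map⁺ f g {x = x} x∈ y∈ =
  ∈-concatMap⁺ (λ x → map (f x) (g x)) (lose x∈ (∈-map⁺ (f x) y∈))

-- Duplicate-free lists with the same members are equal as bags, hence permutations of each other.
unique-set⇒length≡ : {A : Set} {xs ys : List A} → Unique xs → Unique ys →
                     (∀ {z} → z ∈ xs ⇔ z ∈ ys) → length xs ≡ length ys
unique-set⇒length≡ xs! ys! xs∼ys = ↭-length (∼bag⇒↭ (unique∧set⇒bag xs! ys! xs∼ys))

-- Avoidance of 123

-- The condition for prepending `p` to create no 123. Letters `c` at most `p` satisfy it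
-- automatically, since then `c ≤ p < b`.
DecreasingAbove : ℕ → Word → Set
DecreasingAbove p = AllPairs (λ b c → p < b → c ≤ b)

-- Recursion on the first letter lets avoidance be carried through `merge` by induction on suffixes.
data 123-Free : Word → Set where
  []  : 123-Free []
  _∷_ : ∀ {x w} → DecreasingAbove x w → 123-Free w → 123-Free (x ∷ w)

-- A bridge between the index vectors of `OccursAt` and the inductive `123-Free`.
Ascent³-Free : Word → Set
Ascent³-Free w = ∀ {i j k} → i Fin.< j → j Fin.< k →
                 lookup w i < lookup w j → lookup w k ≤ lookup w j

private
  SameOrder : (a b p q : ℕ) → Set
  SameOrder a b p q = (a < b ⇔ p < q) × (a > b ⇔ p > q)

  order-< : ∀ {a b p q} → a < b → p < q → SameOrder a b p q
  order-< a<b p<q = mk⇔ (λ _ → p<q) (λ _ → a<b) ,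
                    mk⇔ (contradiction a<b ∘ <-asym) (contradiction p<q ∘ <-asym)

  order-> : ∀ {a b p q} → b < a → q < p → SameOrder a b p q
  order-> b<a q<p = let e , e′ = order-< b<a q<p in e′ , e

  order-≡ : ∀ {a p} → SameOrder a a p p
  order-≡ = mk⇔ (contradiction refl ∘ <⇒≢) (contradiction refl ∘ <⇒≢) ,
            mk⇔ (contradiction refl ∘ <⇒≢) (contradiction refl ∘ <⇒≢)

  order₃ : ∀ {w i j k} → lookup w i < lookup w j → lookup w j < lookup w k →
           ∀ r s → SameOrder (lookup w (Vec.lookup (i ∷ j ∷ k ∷ []) r))
                             (lookup w (Vec.lookup (i ∷ j ∷ k ∷ []) s))
                             (lookup 123-pattern r) (lookup 123-pattern s)
  order₃ a<b b<c zero             zero             = order-≡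
  order₃ a<b b<c zero             (suc zero)       = order-< a<b (n<1+n 1)
  order₃ a<b b<c zero             (suc (suc zero)) = order-< (<-trans a<b b<c) (s<s z<s)
  order₃ a<b b<c (suc zero)       zero             = order-> a<b (n<1+n 1)
  order₃ a<b b<c (suc zero)       (suc zero)       = order-≡
  order₃ a<b b<c (suc zero)       (suc (suc zero)) = order-< b<c (n<1+n 2)
  order₃ a<b b<c (suc (suc zero)) zero             = order-> (<-trans a<b b<c) (s<s z<s)
  order₃ a<b b<c (suc (suc zero)) (suc zero)       = order-> b<c (n<1+n 2)
  order₃ a<b b<c (suc (suc zero)) (suc (suc zero)) = order-≡

avoids⇔ascent³-free : ∀ w → w Avoids 123-pattern ⇔ Ascent³-Free w
avoids⇔ascent³-free w = mk⇔ forth back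
  where
  forth : w Avoids 123-pattern → Ascent³-Free w
  forth avoids i<j j<k wᵢ<wⱼ = ≮⇒≥ λ wⱼ<wₖ →
    avoids (_ , i<j ∷ j<k ∷ [-] , order₃ {w} wᵢ<wⱼ wⱼ<wₖ)

  back : Ascent³-Free w → w Avoids 123-pattern
  back free (i ∷ j ∷ k ∷ [] , i<j ∷ j<k ∷ [-] , order) =
    ≤⇒≯ (free i<j j<k (from (proj₁ (order zero (suc zero))) (n<1+n 1)))
        (from (proj₁ (order (suc zero) (suc (suc zero)))) (n<1+n 2))

123-free⇔ascent³-free : ∀ w → 123-Free w ⇔ Ascent³-Free w
123-free⇔ascent³-free w = mk⇔ forth (back w)
  where
  forth : ∀ {w} → 123-Free w → Ascent³-Free w
  forth (d ∷ _) {zero}  {suc j} {suc k} _   j<k = allPairs-lookup⁺ d (s≤s⁻¹ j<k)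
  forth (_ ∷ f) {suc i} {suc j} {suc k} i<j j<k = forth f (s≤s⁻¹ i<j) (s≤s⁻¹ j<k)

  back : ∀ w → Ascent³-Free w → 123-Free w
  back []      free = []
  back (x ∷ w) free =
    allPairs-lookup⁻ w (λ j<k → free {zero} z<s (s<s j<k)) ∷
    back w (λ i<j j<k → free (s<s i<j) (s<s j<k))

avoids⇔123-free : ∀ w → w Avoids 123-pattern ⇔ 123-Free w
avoids⇔123-free w =
  mk⇔ (from (123-free⇔ascent³-free w) ∘ to (avoids⇔ascent³-free w))
      (from (avoids⇔ascent³-free w) ∘ to (123-free⇔ascent³-free w))

-- Merging the letters above p, and its inverse

large : ℕ → Word → Word
large p = filter (p <?_)

merge : ℕ → Word → Word
merge p = map (_⊓ suc p)

-- Junk case: once ds is exhausted, letters above p are left unchanged.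
fill : ℕ → Word → Word → Word
fill p ds       []      = []
fill p ds       (x ∷ v) with p <? x
fill p ds       (x ∷ v) | no  _ = x ∷ fill p ds v
fill p []       (x ∷ v) | yes _ = x ∷ fill p [] v
fill p (d ∷ ds) (x ∷ v) | yes _ = d ∷ fill p ds v

decreasingAbove⇒large : ∀ {p w} → DecreasingAbove p w → AllPairs _≥_ (large p w)
decreasingAbove⇒large {p} [] = []
decreasingAbove⇒large {p} {x ∷ w} (px ∷ pxs) with p <? x
... | yes p<x = subst (AllPairs _≥_) (sym (filter-accept (p <?_) p<x))
                  (All.filter⁺ (p <?_) (All.map (λ f → f p<x) px) ∷ decreasingAbove⇒large pxs)
... | no p≮x  = subst (AllPairs _≥_) (sym (filter-reject (p <?_) p≮x))
                  (decreasingAbove⇒large pxs)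

-- A letter above `p` followed by one at most `p` is in order automatically, so only pairs inside
-- `large p w` impose a condition.
large⇒decreasingAbove : ∀ p w → AllPairs _≥_ (large p w) → DecreasingAbove p w
large⇒decreasingAbove p []      _  = []
large⇒decreasingAbove p (x ∷ w) dec with p <? x
... | no p≮x  = All.tabulate (λ _ p<x → contradiction p<x p≮x) ∷
                large⇒decreasingAbove p w (subst (AllPairs _≥_) (filter-reject (p <?_) p≮x) dec)
... | yes p<x with subst (AllPairs _≥_) (filter-accept (p <?_) p<x) dec
...   | x≥ ∷ dec′ = All.tabulate bound ∷ large⇒decreasingAbove p w dec′
  where
  bound : ∀ {c} → c ∈ w → p < x → c ≤ x
  bound {c} c∈w _ with p <? c
  ... | yes p<c = All.lookup x≥ (∈-filter⁺ (p <?_) c∈w p<c)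
  ... | no  p≮c = ≤-trans (≮⇒≥ p≮c) (<⇒≤ p<x)

-- Forwards, monotonicity of truncation yields `x < b` and carries `c ≤ b` over to the truncated
-- letters. Backwards, a middle letter `b` above `p` is handled by `dec`, and one at most `p` is
-- fixed by truncation.
decreasingAbove-merge : ∀ {p w} x → DecreasingAbove p w →
                        DecreasingAbove x w ⇔ DecreasingAbove (x ⊓ suc p) (merge p w)
decreasingAbove-merge {p} x dec = mk⇔
  (AllPairs.map⁺ ∘ AllPairs.map forth)
  (λ dec′ → AllPairs.zipWith back (dec , AllPairs.map⁻ dec′))
  where
  forth : ∀ {b c} → (x < b → c ≤ b) → x ⊓ suc p < b ⊓ suc p → c ⊓ suc p ≤ b ⊓ suc p
  forth f lt = ⊓-monoˡ-≤ (suc p) (f (≰⇒> λ b≤x → <⇒≱ lt (⊓-monoˡ-≤ (suc p) b≤x)))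

  back : ∀ {b c} → (p < b → c ≤ b) × (x ⊓ suc p < b ⊓ suc p → c ⊓ suc p ≤ b ⊓ suc p) →
         x < b → c ≤ b
  back {b} {c} (f , g) x<b with p <? b
  ... | yes p<b = f p<b
  -- Here `b ≤ p`, so `c ⊓ suc p ≤ b` rules out that this minimum is `suc p`; it is then `c` itself.
  ... | no  p≮b = case ⊓-sel c (suc p) of λ
    { (inj₁ c≡) → subst (_≤ b) c≡ le
    ; (inj₂ p≡) → contradiction (subst (_≤ b) p≡ le) p≮b }
    where
    b≡ : b ⊓ suc p ≡ b
    b≡ = m≤n⇒m⊓n≡m (m≤n⇒m≤1+n (≮⇒≥ p≮b))
    le : c ⊓ suc p ≤ b
    le = subst (c ⊓ suc p ≤_) b≡
           (g (subst (x ⊓ suc p <_) (sym b≡) (m<n⇒m⊓o<n (suc p) x<b)))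

-- `decreasingAbove-merge` applies at each letter in turn, because the hypothesis passes to
-- suffixes.
123-free-merge : ∀ {p w} → DecreasingAbove p w → 123-Free w ⇔ 123-Free (merge p w)
123-free-merge dec = mk⇔ (forth dec) (back dec)
  where
  forth : ∀ {p w} → DecreasingAbove p w → 123-Free w → 123-Free (merge p w)
  forth []        []       = []
  forth (_ ∷ dec) (d ∷ fr) = to (decreasingAbove-merge _ dec) d ∷ forth dec fr

  back : ∀ {p w} → DecreasingAbove p w → 123-Free (merge p w) → 123-Free w
  back []        []       = []
  back (_ ∷ dec) (d ∷ fr) = from (decreasingAbove-merge _ dec) d ∷ back dec fr

-- A letter exceeds `p` exactly when its truncation does, so `fill` puts the stored letters back at
-- their original positions.
fill-merge : ∀ p v → fill p (large p v) (merge p v) ≡ v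
fill-merge p [] = refl
fill-merge p (x ∷ v) with p <? x
... | yes p<x rewrite filter-accept (p <?_) {xs = v} p<x with p <? x ⊓ suc p
...   | yes _   = cong (x ∷_) (fill-merge p v)
...   | no  p≮  = contradiction (⊓-pres-m< p<x (n<1+n p)) p≮
fill-merge p (x ∷ v) | no p≮x rewrite filter-reject (p <?_) {xs = v} p≮x with p <? x ⊓ suc p
...   | yes p<  = contradiction (m<n⊓o⇒m<n x (suc p) p<) p≮x
...   | no  _   = cong₂ _∷_ (m≤n⇒m⊓n≡m (m≤n⇒m≤1+n (≮⇒≥ p≮x))) (fill-merge p v)

module _ {p : ℕ} where

  -- Every letter of `v` above `p` is `suc p`, which is also what each letter of `ds` merges to.
  -- Equal lengths keep `fill` away from its junk case.
  merge-fill : ∀ ds v → All (p <_) ds → All (_≤ suc p) v → length (large p v) ≡ length ds →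
               merge p (fill p ds v) ≡ v
  merge-fill ds [] _ _ _ = refl
  merge-fill ds (x ∷ v) p<ds (x≤ ∷ v≤) eq with p <? x
  merge-fill ds (x ∷ v) p<ds (x≤ ∷ v≤) eq | no p≮x
    rewrite filter-reject (p <?_) {xs = v} p≮x =
    cong₂ _∷_ (m≤n⇒m⊓n≡m x≤) (merge-fill ds v p<ds v≤ eq)
  merge-fill ds (x ∷ v) p<ds (x≤ ∷ v≤) eq | yes p<x
    rewrite filter-accept (p <?_) {xs = v} p<x with ds | p<ds
  ... | d ∷ ds | p<d ∷ p<ds =
    cong₂ _∷_ (trans (m≥n⇒m⊓n≡n p<d) (≤-antisym p<x x≤))
              (merge-fill ds v p<ds v≤ (suc-injective eq))

  -- Letters above `p` are replaced by letters above `p`, and equal lengths mean that `ds` is used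
  -- up exactly.
  large-fill : ∀ ds v → All (p <_) ds → length (large p v) ≡ length ds →
               large p (fill p ds v) ≡ ds
  large-fill [] [] _ _ = refl
  large-fill ds (x ∷ v) p<ds eq with p <? x
  large-fill ds (x ∷ v) p<ds eq | no p≮x
    rewrite filter-reject (p <?_) {xs = v} p≮x =
    trans (filter-reject (p <?_) p≮x) (large-fill ds v p<ds eq)
  large-fill ds (x ∷ v) p<ds eq | yes p<x
    rewrite filter-accept (p <?_) {xs = v} p<x with ds | p<ds
  ... | d ∷ ds | p<d ∷ p<ds =
    trans (filter-accept (p <?_) p<d) (cong (d ∷_) (large-fill ds v p<ds (suc-injective eq)))

-- Occurrences

occurrences-≡ : ∀ a w → occurrences a (a ∷ w) ≡ suc (occurrences a w)
occurrences-≡ a w = cong length (filter-accept (a ≟_) refl)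

occurrences-≢ : ∀ {a x} w → a ≢ x → occurrences a (x ∷ w) ≡ occurrences a w
occurrences-≢ {a} w a≢x = cong length (filter-reject (a ≟_) a≢x)

occurrences-none : ∀ {a w} → All (a ≢_) w → occurrences a w ≡ 0
occurrences-none {a} a≢w = cong length (filter-none (a ≟_) a≢w)

occurrences-++ : ∀ a v w → occurrences a (v ++ w) ≡ occurrences a v + occurrences a w
occurrences-++ a v w =
  trans (cong length (filter-++ (a ≟_) v w)) (length-++ (filter (a ≟_) v))

occurrences-replicate : ∀ a n → occurrences a (replicate n a) ≡ n
occurrences-replicate a n =
  trans (cong length (filter-all (a ≟_) (All.replicate⁺ n refl))) (length-replicate n)

occurs⇒∈ : ∀ {a w} → 1 ≤ occurrences a w → a ∈ w
occurs⇒∈ {a} {w} occurs with filter (a ≟_) w in eq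
... | b ∷ _ with b∈w , refl ← ∈-filter⁻ (a ≟_) {xs = w} (subst (b ∈_) (sym eq) (here refl)) = b∈w

∈⇒occurs : ∀ {a w} → a ∈ w → 1 ≤ occurrences a w
∈⇒occurs {a} a∈w = filter-some (a ≟_) a∈w

occurrences-cancel : ∀ a x {v w} → occurrences a (x ∷ v) ≡ occurrences a (x ∷ w) →
                     occurrences a v ≡ occurrences a w
occurrences-cancel a x {v} {w} eq with a ≟ x
... | yes refl = suc-injective (trans (sym (occurrences-≡ a v)) (trans eq (occurrences-≡ a w)))
... | no a≢x   = trans (sym (occurrences-≢ v a≢x)) (trans eq (occurrences-≢ w a≢x))

-- The head of a decreasing word is its maximum. Each head occurs in the other word, so the heads
-- bound each other and can be cancelled.
decreasing-unique : ∀ {v w} → AllPairs _≥_ v → AllPairs _≥_ w →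
                    (∀ a → occurrences a v ≡ occurrences a w) → v ≡ w
decreasing-unique {[]}    {[]}    _ _ _ = refl
decreasing-unique {[]}    {y ∷ w} _ _ eq with () ← trans (eq y) (occurrences-≡ y w)
decreasing-unique {x ∷ v} {[]}    _ _ eq with () ← trans (sym (eq x)) (occurrences-≡ x v)
decreasing-unique {x ∷ v} {y ∷ w} (x≥ ∷ dv) (y≥ ∷ dw) eq
  with ≤-antisym (All.lookup (≤-refl ∷ y≥) (occurs⇒∈ (subst (1 ≤_) (eq x) (∈⇒occurs {x} {x ∷ v} (here refl)))))
                 (All.lookup (≤-refl ∷ x≥) (occurs⇒∈ (subst (1 ≤_) (sym (eq y)) (∈⇒occurs {y} {y ∷ w} (here refl)))))
... | refl = cong (x ∷_) (decreasing-unique dv dw λ a → occurrences-cancel a x (eq a))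

module _ {p a : ℕ} where

  occurrences-large-> : p < a → ∀ w → occurrences a (large p w) ≡ occurrences a w
  occurrences-large-> p<a w =
    cong length (filter-filter-⊆ (a ≟_) (p <?_) (λ { refl → p<a }) w)

  occurrences-large-≤ : a ≤ p → ∀ w → occurrences a (large p w) ≡ 0
  occurrences-large-≤ a≤p w =
    occurrences-none (All.map (λ p<x → <⇒≢ (≤-<-trans a≤p p<x)) (All.all-filter (p <?_) w))

  occurrences-merge-≤ : a ≤ p → ∀ w → occurrences a (merge p w) ≡ occurrences a w
  occurrences-merge-≤ a≤p w =
    trans (length-filter-map (a ≟_) (_⊓ suc p) w)
          (cong length (filter-≐ (λ x → a ≟ x ⊓ suc p) (a ≟_) (forth , back) w))
    where
    forth : ∀ {x} → a ≡ x ⊓ suc p → a ≡ x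
    forth {x} eq with ⊓-sel x (suc p)
    ... | inj₁ e = trans eq e
    ... | inj₂ e = contradiction (trans eq e) (<⇒≢ (s≤s a≤p))

    back : ∀ {x} → a ≡ x → a ≡ x ⊓ suc p
    back refl = sym (m≤n⇒m⊓n≡m (m≤n⇒m≤1+n a≤p))

  occurrences-merge-> : suc p < a → ∀ w → occurrences a (merge p w) ≡ 0
  occurrences-merge-> p<a w = occurrences-none
    (All.map⁺ (All.universal (λ x → ≢-sym (<⇒≢ (≤-<-trans (m⊓n≤n x (suc p)) p<a))) w))

occurrences-merge-suc : ∀ p w → occurrences (suc p) (merge p w) ≡ length (large p w)
occurrences-merge-suc p w =
  trans (length-filter-map (suc p ≟_) (_⊓ suc p) w)
        (cong length (filter-≐ (λ x → suc p ≟ x ⊓ suc p) (p <?_) (forth , back) w))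
  where
  forth : ∀ {x} → suc p ≡ x ⊓ suc p → p < x
  forth {x} eq = subst (_≤ x) (sym eq) (m⊓n≤m x (suc p))

  back : ∀ {x} → p < x → suc p ≡ x ⊓ suc p
  back p<x = sym (m≥n⇒m⊓n≡n p<x)

-- Contents

-- The default 0 is the multiplicity of a letter outside the alphabet, so counts can be prescribed
-- for all naturals at once.
nth : List ℕ → ℕ → ℕ
nth []      _       = 0
nth (l ∷ L) zero    = l
nth (l ∷ L) (suc a) = nth L a

-- Letters are indices into K, so content L is expressed by Counts (0 ∷ L).
Counts : List ℕ → Word → Set
Counts K w = ∀ a → occurrences a w ≡ nth K a

nth-lookup : ∀ L i → nth L (toℕ i) ≡ lookup L i
nth-lookup (l ∷ L) zero    = refl
nth-lookup (l ∷ L) (suc i) = nth-lookup L i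

nth-≥ : ∀ L {a} → length L ≤ a → nth L a ≡ 0
nth-≥ []      _               = refl
nth-≥ (l ∷ L) {suc a} (s≤s le) = nth-≥ L le

nth-drop : ∀ n L a → nth (drop n L) a ≡ nth L (n + a)
nth-drop zero    L       a = refl
nth-drop (suc n) []      a = refl
nth-drop (suc n) (l ∷ L) a = nth-drop n L a

nth-reduceAt-< : ∀ K i {a} → a < toℕ i → nth (reduceAt K i) a ≡ nth K a
nth-reduceAt-< (k ∷ K) (suc i) {zero}  _   = refl
nth-reduceAt-< (k ∷ K) (suc i) {suc a} a<i = nth-reduceAt-< K i (s≤s⁻¹ a<i)

nth-reduceAt-≡ : ∀ K i → nth (reduceAt K i) (toℕ i) ≡ nth K (toℕ i) ∸ 1
nth-reduceAt-≡ (k ∷ K) zero    = refl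
nth-reduceAt-≡ (k ∷ K) (suc i) = nth-reduceAt-≡ K i

nth-reduceAt-suc : ∀ K i → nth (reduceAt K i) (suc (toℕ i)) ≡ sum (drop (suc (toℕ i)) K)
nth-reduceAt-suc (k ∷ K) zero    = refl
nth-reduceAt-suc (k ∷ K) (suc i) = nth-reduceAt-suc K i

nth-reduceAt-> : ∀ K i {a} → suc (toℕ i) < a → nth (reduceAt K i) a ≡ 0
nth-reduceAt-> (k ∷ K) zero    {suc (suc a)} _         = refl
nth-reduceAt-> (k ∷ K) zero    {suc zero}    (s≤s ())
nth-reduceAt-> (k ∷ K) (suc i) {suc a}       (s≤s i<a) = nth-reduceAt-> K i i<a

-- The bounds on letters are encoded by zeros: `nth (0 ∷ L)` vanishes at 0 and beyond `length L`.
hasContent⇔counts : ∀ L w → HasContent L w ⇔ Counts (0 ∷ L) w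
hasContent⇔counts L w = mk⇔ forth back
  where
  forth : HasContent L w → Counts (0 ∷ L) w
  forth (bounds , _) zero = occurrences-none (All.map (<⇒≢ ∘ proj₁) bounds)
  forth (bounds , counts) (suc a) with a <? length L
  ... | yes a<n = subst (λ b → occurrences (suc b) w ≡ nth L b) (toℕ-fromℕ< a<n)
                    (trans (counts (fromℕ< a<n)) (sym (nth-lookup L (fromℕ< a<n))))
  ... | no a≮n  = trans (occurrences-none
                           (All.map (λ (_ , x≤n) eq → a≮n (subst (_≤ length L) (sym eq) x≤n)) bounds))
                        (sym (nth-≥ L (≮⇒≥ a≮n)))

  back : Counts (0 ∷ L) w → HasContent L w
  back counts = All.tabulate (λ {a} a∈w → bound a (subst (1 ≤_) (counts a) (∈⇒occurs a∈w))) ,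
                λ j → trans (counts (suc (toℕ j))) (nth-lookup L j)
    where
    bound : ∀ a → 1 ≤ nth (0 ∷ L) a → 1 ≤ a × a ≤ length L
    bound (suc a) pos = s≤s z≤n , ≰⇒> λ n≤a → <⇒≢ pos (sym (nth-≥ L n≤a))

-- The weakly decreasing word of content `L`, with the alphabet shifted so that the first entry
-- counts the letter `suc k`.
descending : ℕ → List ℕ → Word
descending k []      = []
descending k (l ∷ L) = descending (suc k) L ++ replicate l (suc k)

descending-> : ∀ k L → All (k <_) (descending k L)
descending-> k []      = []
descending-> k (l ∷ L) =
  All.++⁺ (All.map (<-trans (n<1+n k)) (descending-> (suc k) L)) (All.replicate⁺ l (n<1+n k))

descending-decreasing : ∀ k L → AllPairs _≥_ (descending k L)
descending-decreasing k []      = []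
descending-decreasing k (l ∷ L) =
  AllPairs.++⁺ (descending-decreasing (suc k) L) (constant l)
    (All.map (λ k<x → All.replicate⁺ l (<⇒≤ k<x)) (descending-> (suc k) L))
  where
  constant : ∀ n → AllPairs _≥_ (replicate n (suc k))
  constant zero    = []
  constant (suc n) = All.replicate⁺ n ≤-refl ∷ constant n

length-descending : ∀ k L → length (descending k L) ≡ sum L
length-descending k []      = refl
length-descending k (l ∷ L) =
  trans (length-++ (descending (suc k) L))
 (trans (cong₂ _+_ (length-descending (suc k) L) (length-replicate l)) (+-comm (sum L) l))

occurrences-descending : ∀ k L a → occurrences (suc k + a) (descending k L) ≡ nth L a
occurrences-descending k []      a    = refl
occurrences-descending k (l ∷ L) zero rewrite +-identityʳ k =
  trans (occurrences-++ (suc k) (descending (suc k) L) _)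
        (cong₂ _+_ (occurrences-none (All.map <⇒≢ (descending-> (suc k) L)))
                   (occurrences-replicate (suc k) l))
occurrences-descending k (l ∷ L) (suc a) rewrite +-suc k a =
  trans (occurrences-++ (suc (suc k + a)) (descending (suc k) L) _)
 (trans (cong₂ _+_ (occurrences-descending (suc k) L a)
                   (occurrences-none (All.replicate⁺ l (≢-sym (<⇒≢ (s<s (s≤s (m≤m+n k a))))))))
        (+-identityʳ _))

-- Restoring the word from its first letter and the merged remainder

module _ (K : List ℕ) (i : Fin (length K)) where

  private
    p = toℕ i
    rest = drop (suc p) K

  -- What the letters above `p` must spell in any 123-avoiding word of content `K` that starts with
  -- `p`.
  larger : Word
  larger = descending p rest

  restore : Word → Word
  restore v = p ∷ fill p larger v

  larger-> : All (p <_) larger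
  larger-> = descending-> p rest

  occurrences-larger : ∀ {a} → p < a → occurrences a larger ≡ nth K a
  occurrences-larger {a} p<a =
    -- The letter is written as `suc p + (a ∸ suc p)`, which exposes its index in `rest`.
    subst (λ b → occurrences b larger ≡ nth K b) (m+[n∸m]≡n p<a)
      (trans (occurrences-descending p rest (a ∸ suc p))
             (nth-drop (suc p) K (a ∸ suc p)))

  -- Both words are decreasing and have the same multiplicities, so `decreasing-unique` identifies
  -- them.
  large≡larger : ∀ {v} → Counts K (p ∷ v) → DecreasingAbove p v → large p v ≡ larger
  large≡larger {v} counts dec =
    decreasing-unique (decreasingAbove⇒large dec) (descending-decreasing p rest) same
    where
    same : ∀ a → occurrences a (large p v) ≡ occurrences a larger
    same a with p <? a
    ... | yes p<a = trans (occurrences-large-> p<a v)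
                   (trans (sym (occurrences-≢ v (≢-sym (<⇒≢ p<a))))
                   (trans (counts a) (sym (occurrences-larger p<a))))
    ... | no p≮a  = trans (occurrences-large-≤ (≮⇒≥ p≮a) v)
                          (sym (occurrences-none
                            (All.map (λ p<x → <⇒≢ (≤-<-trans (≮⇒≥ p≮a) p<x)) larger->)))

  -- Refilling needs the letters that merging has erased; the content alone determines them as
  -- `larger`.
  restore-merge : ∀ {v} → Counts K (p ∷ v) → DecreasingAbove p v → restore (merge p v) ≡ p ∷ v
  restore-merge {v} counts dec =
    cong (p ∷_) (trans (cong (λ ds → fill p ds (merge p v)) (sym (large≡larger counts dec)))
                       (fill-merge p v))

  counts-merge : ∀ {v} → Counts K (p ∷ v) → DecreasingAbove p v →
                 Counts (reduceAt K i) (merge p v)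
  counts-merge {v} counts dec a with <-cmp a p
  ... | tri< a<p a≢p _ = trans (occurrences-merge-≤ (<⇒≤ a<p) v)
                        (trans (sym (occurrences-≢ v a≢p))
                        (trans (counts a) (sym (nth-reduceAt-< K i a<p))))
  -- The leading `p` is the copy that `_∸ 1` removes.
  ... | tri≈ _ refl _  = trans (occurrences-merge-≤ ≤-refl v)
                        (trans (cong (_∸ 1) (trans (sym (occurrences-≡ p v)) (counts p)))
                               (sym (nth-reduceAt-≡ K i)))
  ... | tri> _ _ p<a with m≤n⇒m<n∨m≡n p<a
  -- All letters of `v` above `p` have become `suc p`, and their number is the tail sum of `K`.
  ...   | inj₂ refl = trans (occurrences-merge-suc p v)
                     (trans (cong length (large≡larger counts dec))
                     (trans (length-descending p rest) (sym (nth-reduceAt-suc K i))))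
  ...   | inj₁ p+1<a = trans (occurrences-merge-> p+1<a v) (sym (nth-reduceAt-> K i p+1<a))

  module _ {v : Word} (counts : Counts (reduceAt K i) v) where

    private
      restoredTail : Word
      restoredTail = fill p larger v

      -- The reduced content has no entry beyond index `suc p`.
      v≤ : All (_≤ suc p) v
      v≤ = All.tabulate λ {a} a∈v → ≮⇒≥ λ p<a →
        <⇒≢ (∈⇒occurs a∈v) (sym (trans (counts a) (nth-reduceAt-> K i p<a)))

      merge-id : merge p v ≡ v
      merge-id = map-id-local (All.map m≤n⇒m⊓n≡m v≤)

      -- `v` is its own merge, so its letters above `p` are the copies of `suc p`, prescribed to be
      -- as many as the tail sum. Hence `larger` fits exactly.
      enough : length (large p v) ≡ length larger
      enough = trans (sym (occurrences-merge-suc p v))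
              (trans (cong (occurrences (suc p)) merge-id)
              (trans (counts (suc p))
              (trans (nth-reduceAt-suc K i) (sym (length-descending p rest)))))

    merge-restore : merge p (restoredTail) ≡ v
    merge-restore = merge-fill larger v larger-> v≤ enough

    decreasingAbove-restore : DecreasingAbove p (restoredTail)
    decreasingAbove-restore = large⇒decreasingAbove p restoredTail
      (subst (AllPairs _≥_) (sym (large-fill larger v larger-> enough))
             (descending-decreasing p rest))

    private
      -- Merging preserves the counts up to `p`, and the restored tail merges to `v`.
      occurrences-restore-≤ : ∀ {a} → a ≤ p →
        occurrences a (restoredTail) ≡ nth (reduceAt K i) a
      occurrences-restore-≤ {a} a≤p =
        trans (sym (occurrences-merge-≤ a≤p restoredTail))
       (trans (cong (occurrences a) merge-restore) (counts a))

    counts-restore : 1 ≤ lookup K i → Counts K (restore v)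
    counts-restore pos a with <-cmp a p
    ... | tri< a<p a≢p _ = trans (occurrences-≢ restoredTail a≢p)
                          (trans (occurrences-restore-≤ (<⇒≤ a<p)) (nth-reduceAt-< K i a<p))
    -- Since the multiplicity is positive, the leading `p` makes up for the truncated subtraction of
    -- 1.
    ... | tri≈ _ refl _ = trans (occurrences-≡ p restoredTail)
                         (trans (cong suc (trans (occurrences-restore-≤ ≤-refl) (nth-reduceAt-≡ K i)))
                                (m+[n∸m]≡n (subst (1 ≤_) (sym (nth-lookup K i)) pos)))
    ... | tri> _ a≢p p<a = trans (occurrences-≢ restoredTail a≢p)
                          (trans (sym (occurrences-large-> p<a restoredTail))
                          (trans (cong (occurrences a) (large-fill larger v larger-> enough))
                                 (occurrences-larger p<a)))

-- The bijection, assembled over all first letters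

∈-avoiders⇔ : ∀ L w → w ∈ avoiders L ⇔ (Counts (0 ∷ L) w × 123-Free w)
∈-avoiders⇔ L w = mk⇔ forth back
  where
  forth : w ∈ avoiders L → Counts (0 ∷ L) w × 123-Free w
  forth w∈ =
    let content , avoids = to (∈-avoiders L w) w∈
    in to (hasContent⇔counts L w) content , to (avoids⇔123-free w) avoids

  back : Counts (0 ∷ L) w × 123-Free w → w ∈ avoiders L
  back (counts , free) =
    from (∈-avoiders L w) (from (hasContent⇔counts L w) counts , from (avoids⇔123-free w) free)

module _ (L : List ℕ) where

  private
    letter : Fin (length L) → ℕ
    letter i = suc (toℕ i)

    restoreAt : Fin (length L) → Word → Word
    restoreAt i = restore (0 ∷ L) (suc i)

  restored : Fin (length L) → List Word
  restored i = map (restoreAt i) (avoiders (reduceAt L i))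

  -- Dropping the first letter and merging the rest undoes restoration on words of the reduced
  -- content.
  restored-unique : ∀ i → Unique (restored i)
  restored-unique i =
    unique-map-leftInverse {f = restoreAt i} (merge (letter i) ∘ drop 1)
      (All.tabulate λ {v} v∈ →
        merge-restore (0 ∷ L) (suc i) (proj₁ (to (∈-avoiders⇔ (reduceAt L i) v) v∈)))
      (avoiders-unique (reduceAt L i))

  -- Words restored at different indices start with different letters.
  restored-disjoint : ∀ {i j} → i ≢ j → Disjoint (restored i) (restored j)
  restored-disjoint {i} {j} i≢j =
    disjoint-map (λ _ _ eq → i≢j (toℕ-injective (suc-injective (∷-injectiveˡ eq))))
      (avoiders (reduceAt L i)) (avoiders (reduceAt L j))

  concatMap-restored-unique : Unique (concatMap restored (support L))
  concatMap-restored-unique = Unique.concat⁺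
    (All.map⁺ (All.universal restored-unique (support L)))
    (AllPairs.map⁺ (AllPairs.map restored-disjoint
      (Unique.filter⁺ (λ i → 1 ≤? lookup L i) (Unique.allFin⁺ (length L)))))

  first∈support : ∀ i v → Counts (0 ∷ L) (letter i ∷ v) → i ∈ support L
  first∈support i v counts =
    ∈-filter⁺ (λ i → 1 ≤? lookup L i) (∈-allFin i)
      (subst (1 ≤_) (trans (counts (letter i)) (nth-lookup L i))
             (∈⇒occurs {letter i} {letter i ∷ v} (here refl)))

  counts∧123-free⇒restored : ∀ i v → Counts (0 ∷ L) (letter i ∷ v) → 123-Free (letter i ∷ v) →
                             letter i ∷ v ∈ concatMap restored (support L)
  counts∧123-free⇒restored i v counts (dec ∷ free) =
    subst (_∈ concatMap restored (support L)) (restore-merge (0 ∷ L) (suc i) counts dec)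
      (∈-concatMap-map⁺ restoreAt (λ i → avoiders (reduceAt L i)) (first∈support i v counts)
        (from (∈-avoiders⇔ (reduceAt L i) (merge (letter i) v))
          (counts-merge (0 ∷ L) (suc i) counts dec , to (123-free-merge dec) free)))

  avoiders⇒restored : 1 ≤ sum L → ∀ w → w ∈ avoiders L → w ∈ concatMap restored (support L)
  avoiders⇒restored pos w w∈ = go w (to (∈-avoiders L w) w∈)
    where
    go : ∀ w → HasContent L w × w Avoids 123-pattern → w ∈ concatMap restored (support L)
    -- The empty word has length 0, which `pos` excludes.
    go []      (content , _) = contradiction (content-length L [] content) (<⇒≢ pos)
    go (x ∷ v) (content@((s≤s z≤n , x<n) ∷ _ , _) , avoids) =
      subst (_∈ concatMap restored (support L)) eq
        (counts∧123-free⇒restored (fromℕ< x<n) v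
          (subst (Counts (0 ∷ L)) (sym eq) (to (hasContent⇔counts L (x ∷ v)) content))
          (subst 123-Free (sym eq) (to (avoids⇔123-free (x ∷ v)) avoids)))
      where
      eq : letter (fromℕ< x<n) ∷ v ≡ x ∷ v
      eq = cong (λ a → suc a ∷ v) (toℕ-fromℕ< x<n)

  -- The restored tail merges to `v`, so avoidance is pulled back along `merge`.
  restoreAt∈avoiders : ∀ i v → i ∈ support L → v ∈ avoiders (reduceAt L i) →
                       restoreAt i v ∈ avoiders L
  restoreAt∈avoiders i v i∈ v∈ = from (∈-avoiders⇔ L (restoreAt i v))
    (counts-restore (0 ∷ L) (suc i) {v} counts positive , dec ∷ from (123-free-merge dec) free)
    where
    -- `reduceAt (0 ∷ L) (suc i)` computes to `0 ∷ reduceAt L i`, so no conversion arises.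
    counts : Counts (reduceAt (0 ∷ L) (suc i)) v
    counts = proj₁ (to (∈-avoiders⇔ (reduceAt L i) v) v∈)

    dec : DecreasingAbove (letter i) (drop 1 (restoreAt i v))
    dec = decreasingAbove-restore (0 ∷ L) (suc i) {v} counts

    free : 123-Free (merge (letter i) (drop 1 (restoreAt i v)))
    free = subst 123-Free (sym (merge-restore (0 ∷ L) (suc i) {v} counts))
             (proj₂ (to (∈-avoiders⇔ (reduceAt L i) v) v∈))

    positive : 1 ≤ lookup L i
    positive = proj₂ (∈-filter⁻ (λ i → 1 ≤? lookup L i) {xs = allFin (length L)} i∈)

  restored⇒avoiders : ∀ w → w ∈ concatMap restored (support L) → w ∈ avoiders L
  restored⇒avoiders w w∈ =
    let i , v , i∈ , v∈ , w≡ =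
          ∈-concatMap-map⁻ restoreAt (λ i → avoiders (reduceAt L i)) (support L) w∈
    in subst (_∈ avoiders L) (sym w≡) (restoreAt∈avoiders i v i∈ v∈)

theorem1 : (L : List ℕ) → sum L ≥ 1 →
    A L ≡ sum (map (λ i → A (reduceAt L i)) (support L))
theorem1 L pos =
  trans (unique-set⇒length≡ (avoiders-unique L) (concatMap-restored-unique L)
           (λ {w} → mk⇔ (avoiders⇒restored L pos w) (restored⇒avoiders L w)))
 (trans (length-concatMap (restored L) (support L))
        (cong sum (map-cong (λ i → length-map (restore (0 ∷ L) (suc i)) (avoiders (reduceAt L i)))
                            (support L))))
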